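{- Let $k$ and $i$ be integers with $1\le i\le k/2$ and $k\equiv 2\pmod 3$. Then for all integers $n\ge 0$: (1) if $i\equiv 2\pmod 9$, then $S_{k,i}(9n+5)\equiv S_{k,i}(9n+8)\equiv 0\pmod 4$; (2) if $i\equiv 5\pmod 9$, then $S_{k,i}(9n+2)\equiv S_{k,i}(9n+8)\equiv 0\pmod 4$; (3) if $i\equiv 8\pmod 9$, then $S_{k,i}(9n+2)\equiv S_{k,i}(9n+5)\equiv 0\pmod 4$.
   Context: Write $(a;q)_\infty=\prod_{m\ge 0}(1-aq^m)$, $(a)_\infty=(a;q)_\infty$, and $(a_1,\ldots,a_r;q)_\infty=(a_1;q)_\infty\cdots(a_r;q)_\infty$. For integers $k,i$ with $1\le i\le k/2$, the integers $S_{k,i}(n)$, $n\ge 0$, are given by the generating function $$\sum_{n\ge 0}S_{k,i}(n)q^n=\frac{(-q)_\infty\,(q^i,q^{k-i},q^k;q^k)_\infty}{(q)_\infty}.$$ Combinatorially (an overpartition of $n$ is a partition of $n$ in which the first occurrence of each integer may be overlined): if $i<k/2$, $S_{k,i}(n)$ is the number of overpartitions of $n$ whose non-overlined parts are not congruent to $0,\pm i$ modulo $k$; if $i=k/2$, it is the number of overpartitions of $n$ with no part divisible by $k/2$. -}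

module Defs where

open import Data.Bool.Base using (if_then_else_)
open import Data.Fin.Base using (Fin; zero; suc; toℕ)
open import Data.Fin.Properties using (toℕ≤pred[n])
open import Data.Integer.Base using (ℤ; 0ℤ; 1ℤ; _+_; _*_; _-_; -_)
import Data.Integer.Properties as ℤ
open import Data.Nat.Base as ℕ using (ℕ; zero; suc; _∸_; _≡ᵇ_; _≤_; _≤′_; ≤′-refl; ≤′-step)
import Data.Nat.Properties as ℕ
open import Relation.Binary.PropositionalEquality using (_≡_; refl; sym; trans; cong; cong₂; _≗_)
open import Algebra.Properties.Monoid.Sum ℤ.+-0-monoid
  using (sum⁺-syntax; sum; sum-cong-≗; sum-replicate-zero)

-- Formal power series in q over ℤ; f n is the coefficient of qⁿ.
Series : Set
Series = ℕ → ℤ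

infixl 7 _⊗_ _⊘_
infixl 6 _⊖_
infix  8 ⊝_

𝟙 : Series
𝟙 zero    = 1ℤ
𝟙 (suc _) = 0ℤ

q^_ : ℕ → Series
(q^ e) n = if n ≡ᵇ e then 1ℤ else 0ℤ

⊝_ : Series → Series
(⊝ f) n = - f n

_⊖_ : Series → Series → Series
(f ⊖ g) n = f n - g n

_⊗_ : Series → Series → Series
(f ⊗ g) n = ∑[ j ≤ n ] (f (toℕ j) * g (n ∸ toℕ j))

-- Quotient f / g, meaningful when g has constant term 1: writing
-- f = f₀ + q f⁺ and g = 1 + q g⁺, one has f / g = f₀ + q ((f⁺ - f₀ g⁺) / g).
-- See ⊘-⊗ below.
_⊘_ : Series → Series → Series
(f ⊘ g) zero    = f zero
(f ⊘ g) (suc n) = ((λ m → f (suc m) - f zero * g (suc m)) ⊘ g) n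

∏ : ℕ → (ℕ → Series) → Series
∏ zero    F = 𝟙
∏ (suc M) F = F M ⊗ ∏ M F

factor : Series → ℕ → ℕ → Series
factor a k m = 𝟙 ⊖ a ⊗ q^ (k ℕ.* m)

-- The product (a ; q^k)_∞, for k ≥ 1 and a without constant term.
-- The factors with m ≥ n are then 1 modulo q^(n+1), so the coefficient of qⁿ
-- is read off from the first n factors; see poch-limit below.
⟨_,q^_⟩∞ : Series → ℕ → Series
⟨ a ,q^ k ⟩∞ n = ∏ n (factor a k) n

genFun : ℕ → ℕ → Series
genFun k i =
  (⟨ ⊝ q^ 1 ,q^ 1 ⟩∞
    ⊗ (⟨ q^ i ,q^ k ⟩∞ ⊗ ⟨ q^ (k ∸ i) ,q^ k ⟩∞ ⊗ ⟨ q^ k ,q^ k ⟩∞))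
  ⊘ ⟨ q^ 1 ,q^ 1 ⟩∞

S : ℕ → ℕ → ℕ → ℤ
S k i n = genFun k i n

⊘-⊗ : ∀ f g → g 0 ≡ 1ℤ → (f ⊘ g) ⊗ g ≗ f
⊘-⊗ f g g₀≡1 zero =
  trans (ℤ.+-identityʳ _) (trans (cong (f 0 *_) g₀≡1) (ℤ.*-identityʳ _))
⊘-⊗ f g g₀≡1 (suc n) =
  trans (cong (f 0 * g (suc n) +_) (⊘-⊗ (λ m → f (suc m) - f 0 * g (suc m)) g g₀≡1 n))
    (cancel (f 0 * g (suc n)) (f (suc n)))
  where
  cancel : ∀ x y → x + (y - x) ≡ y
  cancel x y = trans (ℤ.+-comm x (y - x))
    (trans (ℤ.+-assoc y (- x) x)
      (trans (cong (y +_) (ℤ.+-inverseˡ x)) (ℤ.+-identityʳ y)))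

sum-zero : ∀ {n} (t : Fin n → ℤ) → (∀ j → t j ≡ 0ℤ) → sum t ≡ 0ℤ
sum-zero {n} t t≡0 = trans (sum-cong-≗ t≡0) (sum-replicate-zero n)

q^-below : ∀ e n → n ℕ.< e → (q^ e) n ≡ 0ℤ
q^-below (suc e) zero    _           = refl
q^-below (suc e) (suc n) (ℕ.s≤s n<e) = q^-below e n n<e

⊗-q^-low : ∀ a e n → a 0 ≡ 0ℤ → n ≤ e → (a ⊗ q^ e) n ≡ 0ℤ
⊗-q^-low a e n a₀≡0 n≤e = sum-zero _ term
  where
  term : (j : Fin (suc n)) → a (toℕ j) * (q^ e) (n ∸ toℕ j) ≡ 0ℤ
  term zero    = trans (cong (_* (q^ e) n) a₀≡0) (ℤ.*-zeroˡ ((q^ e) n))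
  term (suc j) = trans
    (cong (a (suc (toℕ j)) *_)
      (q^-below e (n ∸ suc (toℕ j)) (ℕ.<-≤-trans (below n j) n≤e)))
    (ℤ.*-zeroʳ (a (suc (toℕ j))))
    where
    below : ∀ n (j : Fin n) → n ∸ suc (toℕ j) ℕ.< n
    below (suc n) j = ℕ.s≤s (ℕ.m∸n≤m n (toℕ j))

∏-step : ∀ a k n M → a 0 ≡ 0ℤ → 1 ≤ k → n ≤ M →
         ∏ (suc M) (factor a k) n ≡ ∏ M (factor a k) n
∏-step a k n M a₀≡0 1≤k n≤M =
  trans (cong₂ _+_ headTerm (sum-zero _ tailTerm)) (ℤ.+-identityʳ _)
  where
  P = ∏ M (factor a k)

  M≤kM : M ≤ k ℕ.* M
  M≤kM = ℕ.m≤n*m M k {{ℕ.>-nonZero 1≤k}}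

  low : ∀ m → m ≤ n → factor a k M m ≡ 𝟙 m
  low m m≤n = trans
    (cong (λ x → 𝟙 m - x)
      (⊗-q^-low a (k ℕ.* M) m a₀≡0 (ℕ.≤-trans m≤n (ℕ.≤-trans n≤M M≤kM))))
    (ℤ.+-identityʳ (𝟙 m))

  headTerm : factor a k M 0 * P n ≡ P n
  headTerm = trans (cong (_* P n) (low 0 ℕ.z≤n)) (ℤ.*-identityˡ (P n))

  tailTerm : (j : Fin n) →
             factor a k M (suc (toℕ j)) * P (n ∸ suc (toℕ j)) ≡ 0ℤ
  tailTerm j = trans
    (cong (_* P (n ∸ suc (toℕ j))) (low (suc (toℕ j)) (toℕ≤pred[n] (suc j))))
    (ℤ.*-zeroˡ (P (n ∸ suc (toℕ j))))

poch-limit : ∀ a k n M → a 0 ≡ 0ℤ → 1 ≤ k → n ≤ M →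
             ∏ M (factor a k) n ≡ ⟨ a ,q^ k ⟩∞ n
poch-limit a k n M a₀≡0 1≤k n≤M = go (ℕ.≤⇒≤′ n≤M)
  where
  go : ∀ {M} → n ≤′ M → ∏ M (factor a k) n ≡ ⟨ a ,q^ k ⟩∞ n
  go ≤′-refl         = refl
  go (≤′-step n≤′M) = trans (∏-step a k n _ a₀≡0 1≤k (ℕ.≤′⇒≤ n≤′M)) (go n≤′M)

{-# OPTIONS --safe #-}

-- Let φ = (q,q,q²;q²)_∞ = (q)_∞ / (-q)_∞ and Θ = (q^i,q^(k-i),q^k;q^k)_∞, so that the generating
-- function G of S_{k,i} satisfies G φ = Θ. As (q)_∞ and (-q)_∞ agree modulo 2, D = φ - 1 is even,
-- whence G = Θ - Θ D + G D² ≡ Θ - Θ D modulo 4. Both Θ and φ are sparse by the Jacobi triple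
-- product: φ is supported on squares, i.e. on residues 0 mod 9 and 1 mod 3, and Θ on the numbers
-- k m(m-1)/2 + i m with m ∈ ℤ, i.e. (as k ≡ i ≡ 2 mod 3) on the residues 0 mod 3 and i mod 9.
-- A sum of a number of each kind which is 2 mod 3 is therefore i mod 9.
--
-- For the triple product, write Q = q^k, z = q^s, w = q^t with z w = Q, and put
-- θ_m = (-1)^m z^m Q^(m(m-1)/2) for m ∈ ℤ. One shows by induction on b that
-- (Q)_∞ (z;Q)_∞ (w;Q)_b = Σ_{m ≥ -b} θ_m (Q^(b+m+1);Q)_∞; the case b = 0 comes from the functional
-- equation F(z) = (1 - z) F(zQ) of the right-hand side. All sums are cut off after finitely many
-- terms and compared modulo a power of q.
module Submission where

open import Defs
open import Data.Nat using (ℕ; _+_; _*_; _≤_; _%_)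
open import Data.Integer using (+_)
open import Data.Integer.Divisibility.Signed using (_∣_)
open import Data.Product using (_×_)
open import Relation.Binary.PropositionalEquality using (_≡_)

open import Algebra.Bundles using (CommutativeRing)
open import Algebra.Properties.Monoid.Sum using (sum-cong-≗)
import Algebra.Solver.Ring
open import Algebra.Solver.Ring.AlmostCommutativeRing
  using (fromCommutativeRing; _-Raw-AlmostCommutative⟶_)
open import Data.Fin.Base using (Fin; zero; suc; toℕ)
open import Data.Fin.Properties using (toℕ≤pred[n])
open import Data.Integer using (ℤ; 0ℤ; 1ℤ)
import Data.Integer as ℤ
open import Data.Integer.Divisibility.Signed
  using (divides; ∣-trans; ∣-reflexive; *-monoʳ-∣; *-monoˡ-∣; ∣m∣n⇒∣m+n; ∣m+n∣m⇒∣n; ∣m⇒∣m*n; 0∣⇒≡0)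
import Data.Integer.Properties as ℤ
open import Data.Integer.Solver using (module +-*-Solver)
open import Data.Maybe.Base using (Maybe; map)
open import Data.Nat using (zero; suc; _∸_; _/_; _<_; _<?_; _≟_; z≤n; s≤s; >-nonZero)
open import Data.Nat.Divisibility.Core using (divides-refl)
open import Data.Nat.DivMod
open import Data.Nat.Properties hiding (_≟_; _<?_)
open import Data.Nat.Tactic.RingSolver using (solve-∀)
open import Data.Product using (_,_; ∃-syntax)
open import Data.Sum using (_⊎_; inj₁; inj₂)
open import Function using (_∘_)
open import Level using (0ℓ)
open import Relation.Binary.Bundles using (Setoid)
open import Relation.Binary.PropositionalEquality
  using (_≢_; _≗_; refl; sym; trans; cong; cong₂; subst; _→-setoid_; module ≡-Reasoning)
import Relation.Binary.Reasoning.Setoid as SetoidReasoning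
open import Relation.Nullary using (¬_; yes; no; contradiction)
open import Relation.Nullary.Decidable using (dec⇒maybe; _⊎-dec_)

-- The ring of formal power series

infixl 6 _⊕_

_⊕_ : Series → Series → Series
(f ⊕ g) n = f n ℤ.+ g n

tail : Series → Series
tail f n = f (suc n)

constant : ℤ → Series
constant c zero    = c
constant c (suc _) = 0ℤ

⊗-cong : ∀ {f f′ g g′} → f ≗ f′ → g ≗ g′ → f ⊗ g ≗ f′ ⊗ g′
⊗-cong p q zero = cong (ℤ._+ 0ℤ) (cong₂ ℤ._*_ (p 0) (q 0))
-- By the definition of `sum`, the coefficient of `f ⊗ g` at `suc n` is `f 0 * g (suc n)` plus the
-- coefficient of `tail f ⊗ g` at `n`. The inductions on coefficients below rest on this recursion.
⊗-cong p q (suc n) = cong₂ ℤ._+_ (cong₂ ℤ._*_ (p 0) (q (suc n))) (⊗-cong (λ m → p (suc m)) q n)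

⊗-congˡ : ∀ f {g g′} → g ≗ g′ → f ⊗ g ≗ f ⊗ g′
⊗-congˡ f = ⊗-cong {f} λ _ → refl

⊗-congʳ : ∀ g {f f′} → f ≗ f′ → f ⊗ g ≗ f′ ⊗ g
⊗-congʳ g f≗f′ = ⊗-cong {g = g} f≗f′ λ _ → refl

⊗-distribʳ : ∀ h f g → (f ⊕ g) ⊗ h ≗ (f ⊗ h) ⊕ (g ⊗ h)
⊗-distribʳ h f g zero =
  solve 3 (λ a b c → (a :+ b) :* c :+ con 0ℤ := (a :* c :+ con 0ℤ) :+ (b :* c :+ con 0ℤ)) refl
    (f 0) (g 0) (h 0)
  where open +-*-Solver
⊗-distribʳ h f g (suc n) = trans
  (cong (ℤ._+_ ((f 0 ℤ.+ g 0) ℤ.* h (suc n))) (⊗-distribʳ h (tail f) (tail g) n))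
  (solve 5 (λ a b c x y → (a :+ b) :* c :+ (x :+ y) := (a :* c :+ x) :+ (b :* c :+ y)) refl
    (f 0) (g 0) (h (suc n)) ((tail f ⊗ h) n) ((tail g ⊗ h) n))
  where open +-*-Solver

⊗-scaleˡ : ∀ c f g n → ((λ m → c ℤ.* f m) ⊗ g) n ≡ c ℤ.* (f ⊗ g) n
⊗-scaleˡ c f g zero =
  solve 3 (λ c a b → c :* a :* b :+ con 0ℤ := c :* (a :* b :+ con 0ℤ)) refl c (f 0) (g 0)
  where open +-*-Solver
⊗-scaleˡ c f g (suc n) = trans
  (cong (ℤ._+_ (c ℤ.* f 0 ℤ.* g (suc n))) (⊗-scaleˡ c (tail f) g n))
  (solve 4 (λ c a b x → c :* a :* b :+ c :* x := c :* (a :* b :+ x)) refl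
    c (f 0) (g (suc n)) ((tail f ⊗ g) n))
  where open +-*-Solver

-- The mirror image of the defining recursion, peeling the right factor instead of the left one; it
-- turns `⊗-comm` into an induction.
⊗-sucʳ : ∀ f g n → (f ⊗ g) (suc n) ≡ (f ⊗ tail g) n ℤ.+ f (suc n) ℤ.* g 0
⊗-sucʳ f g zero =
  solve 4 (λ a b c d → a :* b :+ (c :* d :+ con 0ℤ) := (a :* b :+ con 0ℤ) :+ c :* d) refl
    (f 0) (g 1) (f 1) (g 0)
  where open +-*-Solver
⊗-sucʳ f g (suc n) = trans
  (cong (ℤ._+_ (f 0 ℤ.* g (suc (suc n)))) (⊗-sucʳ (tail f) g n))
  (sym (ℤ.+-assoc (f 0 ℤ.* g (suc (suc n))) ((tail f ⊗ tail g) n) (f (suc (suc n)) ℤ.* g 0)))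

⊗-comm : ∀ f g → f ⊗ g ≗ g ⊗ f
⊗-comm f g zero    = cong (ℤ._+ 0ℤ) (ℤ.*-comm (f 0) (g 0))
⊗-comm f g (suc n) = begin
  f 0 ℤ.* g (suc n) ℤ.+ (tail f ⊗ g) n  ≡⟨ cong₂ ℤ._+_ (ℤ.*-comm (f 0) (g (suc n))) (⊗-comm (tail f) g n) ⟩
  g (suc n) ℤ.* f 0 ℤ.+ (g ⊗ tail f) n  ≡⟨ ℤ.+-comm (g (suc n) ℤ.* f 0) ((g ⊗ tail f) n) ⟩
  (g ⊗ tail f) n ℤ.+ g (suc n) ℤ.* f 0  ≡⟨ sym (⊗-sucʳ g f n) ⟩
  (g ⊗ f) (suc n)                       ∎
  where open ≡-Reasoning

⊗-assoc : ∀ f g h → (f ⊗ g) ⊗ h ≗ f ⊗ (g ⊗ h)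
⊗-assoc f g h zero =
  solve 3 (λ a b c → (a :* b :+ con 0ℤ) :* c :+ con 0ℤ := a :* (b :* c :+ con 0ℤ) :+ con 0ℤ) refl
    (f 0) (g 0) (h 0)
  where open +-*-Solver
⊗-assoc f g h (suc n) = begin
  -- Here `tail (f ⊗ g)` is already unfolded into `f 0` times `tail g` plus `tail f ⊗ g`.
  (f ⊗ g) 0 ℤ.* h (suc n) ℤ.+ (((λ m → f 0 ℤ.* tail g m) ⊕ (tail f ⊗ g)) ⊗ h) n
    ≡⟨ cong (ℤ._+_ ((f ⊗ g) 0 ℤ.* h (suc n))) (⊗-distribʳ h (λ m → f 0 ℤ.* tail g m) (tail f ⊗ g) n) ⟩
  (f ⊗ g) 0 ℤ.* h (suc n) ℤ.+ (((λ m → f 0 ℤ.* tail g m) ⊗ h) n ℤ.+ ((tail f ⊗ g) ⊗ h) n)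
    ≡⟨ cong (ℤ._+_ ((f ⊗ g) 0 ℤ.* h (suc n)))
         (cong₂ ℤ._+_ (⊗-scaleˡ (f 0) (tail g) h n) (⊗-assoc (tail f) g h n)) ⟩
  (f ⊗ g) 0 ℤ.* h (suc n) ℤ.+ (f 0 ℤ.* (tail g ⊗ h) n ℤ.+ (tail f ⊗ (g ⊗ h)) n)
    ≡⟨ solve 5 (λ a b c x y → (a :* b :+ con 0ℤ) :* c :+ (a :* x :+ y) := a :* (b :* c :+ x) :+ y) refl
         (f 0) (g 0) (h (suc n)) ((tail g ⊗ h) n) ((tail f ⊗ (g ⊗ h)) n) ⟩
  (f ⊗ (g ⊗ h)) (suc n) ∎
  where
  open ≡-Reasoning
  open +-*-Solver

𝟘 : Series
𝟘 _ = 0ℤ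

⊗-zeroˡ : ∀ g → 𝟘 ⊗ g ≗ 𝟘
⊗-zeroˡ g n = sum-zero {suc n} _ (λ j → ℤ.*-zeroˡ (g (n ∸ toℕ j)))

constant-⊗ : ∀ c f n → (constant c ⊗ f) n ≡ c ℤ.* f n
constant-⊗ c f zero    = ℤ.+-identityʳ _
constant-⊗ c f (suc n) =
  trans (cong (ℤ._+_ (c ℤ.* f (suc n))) (⊗-zeroˡ f n)) (ℤ.+-identityʳ _)

𝟙≗constant : 𝟙 ≗ constant 1ℤ
𝟙≗constant zero    = refl
𝟙≗constant (suc _) = refl

⊗-identityˡ : ∀ f → 𝟙 ⊗ f ≗ f
⊗-identityˡ f n = trans (⊗-congʳ f 𝟙≗constant n)
  (trans (constant-⊗ 1ℤ f n) (ℤ.*-identityˡ (f n)))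

seriesRing : CommutativeRing 0ℓ 0ℓ
seriesRing = record
  { Carrier = Series ; _≈_ = _≗_ ; _+_ = _⊕_ ; _*_ = _⊗_ ; -_ = ⊝_ ; 0# = 𝟘 ; 1# = 𝟙
  ; isCommutativeRing = record
    { isRing = record
      { +-isAbelianGroup = record
        { isGroup = record
          { isMonoid = record
            { isSemigroup = record
              { isMagma = record
                { isEquivalence = Setoid.isEquivalence (ℕ →-setoid ℤ)
                ; ∙-cong = λ p q n → cong₂ ℤ._+_ (p n) (q n) }
              ; assoc = λ f g h n → ℤ.+-assoc (f n) (g n) (h n) }
            ; identity = (λ f n → ℤ.+-identityˡ (f n)) , (λ f n → ℤ.+-identityʳ (f n)) }
          ; inverse = (λ f n → ℤ.+-inverseˡ (f n)) , (λ f n → ℤ.+-inverseʳ (f n))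
          ; ⁻¹-cong = λ p n → cong ℤ.-_ (p n) }
        ; comm = λ f g n → ℤ.+-comm (f n) (g n) }
      ; *-cong = ⊗-cong
      ; *-assoc = ⊗-assoc
      ; *-identity = ⊗-identityˡ , λ f n → trans (⊗-comm f 𝟙 n) (⊗-identityˡ f n)
      ; distrib =
          (λ f g h n → trans (⊗-comm f (g ⊕ h) n)
            (trans (⊗-distribʳ f g h n) (cong₂ ℤ._+_ (⊗-comm g f n) (⊗-comm h f n))))
        , ⊗-distribʳ }
    ; *-comm = ⊗-comm }
  }

open CommutativeRing seriesRing using (setoid)
  renaming (refl to ≗-refl; sym to ≗-sym; trans to ≗-trans)

-- The solver takes its coefficients from ℤ, where equality is decidable, so that terms can cancel.
-- As `con 1ℤ` denotes `constant 1ℤ`, the unit `𝟙` enters solver calls as a variable.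
constantMorphism : CommutativeRing.rawRing ℤ.+-*-commutativeRing
                     -Raw-AlmostCommutative⟶ fromCommutativeRing seriesRing
constantMorphism = record
  { ⟦_⟧    = constant
  ; +-homo = λ { _ _ zero → refl ; _ _ (suc _) → refl }
  ; *-homo = λ { a b zero → sym (constant-⊗ a (constant b) 0)
               ; a b (suc n) → sym (trans (constant-⊗ a (constant b) (suc n)) (ℤ.*-zeroʳ a)) }
  ; -‿homo = λ { _ zero → refl ; _ (suc _) → refl }
  ; 0-homo = λ { zero → refl ; (suc _) → refl }
  ; 1-homo = λ n → sym (𝟙≗constant n)
  }

constant-≟ : ∀ a b → Maybe (constant a ≗ constant b)
constant-≟ a b = map (λ { refl _ → refl }) (dec⇒maybe (a ℤ.≟ b))

module SeriesSolver = Algebra.Solver.Ring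
  (CommutativeRing.rawRing ℤ.+-*-commutativeRing) (fromCommutativeRing seriesRing) constantMorphism
  constant-≟

-- Congruence modulo q^N and infinite products

infix 4 _≈[_]_

_≈[_]_ : Series → ℕ → Series → Set
f ≈[ N ] g = ∀ n → n < N → f n ≡ g n

truncated : ℕ → Setoid 0ℓ 0ℓ
truncated N = record
  { Carrier = Series ; _≈_ = _≈[ N ]_
  ; isEquivalence = record
    { refl  = λ _ _ → refl
    ; sym   = λ p n n<N → sym (p n n<N)
    ; trans = λ p q n n<N → trans (p n n<N) (q n n<N) } }

≗⇒≈ : ∀ {N f g} → f ≗ g → f ≈[ N ] g
≗⇒≈ p n _ = p n

≈-weaken : ∀ {M N f g} → M ≤ N → f ≈[ N ] g → f ≈[ M ] g
≈-weaken M≤N p n n<M = p n (<-≤-trans n<M M≤N)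

≈-⊗ : ∀ {N f f′ g g′} → f ≈[ N ] f′ → g ≈[ N ] g′ → f ⊗ g ≈[ N ] f′ ⊗ g′
≈-⊗ p q n n<N = sum-cong-≗ ℤ.+-0-monoid {suc n} λ j → cong₂ ℤ._*_
  (p (toℕ j) (≤-<-trans (toℕ≤pred[n] j) n<N))
  (q (n ∸ toℕ j) (≤-<-trans (m∸n≤m n (toℕ j)) n<N))

≈-⊗ˡ : ∀ {N} f {g g′} → g ≈[ N ] g′ → f ⊗ g ≈[ N ] f ⊗ g′
≈-⊗ˡ f = ≈-⊗ {f = f} λ _ _ → refl

≈-⊗ʳ : ∀ {N} g {f f′} → f ≈[ N ] f′ → f ⊗ g ≈[ N ] f′ ⊗ g
≈-⊗ʳ g f≈f′ = ≈-⊗ {g = g} f≈f′ λ _ _ → refl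

-- If j + (n - j) < a + b, then j < a or n - j < b, so each summand has a zero factor.
⊗-order : ∀ {a b} f g → f ≈[ a ] 𝟘 → g ≈[ b ] 𝟘 → f ⊗ g ≈[ a + b ] 𝟘
⊗-order {a} {b} f g f≈0 g≈0 n n<a+b = sum-zero {suc n} _ term
  where
  term : (j : Fin (suc n)) → f (toℕ j) ℤ.* g (n ∸ toℕ j) ≡ 0ℤ
  term j with toℕ j <? a | n ∸ toℕ j <? b
  ... | yes j<a | _ = trans (cong (ℤ._* g (n ∸ toℕ j)) (f≈0 (toℕ j) j<a)) (ℤ.*-zeroˡ (g (n ∸ toℕ j)))
  ... | no _ | yes l<b = trans (cong (f (toℕ j) ℤ.*_) (g≈0 (n ∸ toℕ j) l<b)) (ℤ.*-zeroʳ (f (toℕ j)))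
  ... | no j≮a | no l≮b = contradiction n<a+b (≤⇒≯
    (subst (a + b ≤_) (m+[n∸m]≡n (toℕ≤pred[n] j)) (+-mono-≤ (≮⇒≥ j≮a) (≮⇒≥ l≮b))))

q^0≗𝟙 : q^ 0 ≗ 𝟙
q^0≗𝟙 zero    = refl
q^0≗𝟙 (suc _) = refl

q^-⊗ : ∀ a b → q^ a ⊗ q^ b ≗ q^ (a + b)
q^-⊗ zero    b = ≗-trans (⊗-congʳ (q^ b) q^0≗𝟙) (⊗-identityˡ (q^ b))
q^-⊗ (suc a) b zero    = refl
q^-⊗ (suc a) b (suc n) = trans
  (cong (ℤ._+ (q^ a ⊗ q^ b) n) (ℤ.*-zeroˡ ((q^ b) (suc n))))
  (trans (ℤ.+-identityˡ _) (q^-⊗ a b n))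

q^-≢ : ∀ e n → n ≢ e → (q^ e) n ≡ 0ℤ
q^-≢ zero    zero    n≢e = contradiction refl n≢e
q^-≢ zero    (suc n) n≢e = refl
q^-≢ (suc e) zero    n≢e = refl
q^-≢ (suc e) (suc n) n≢e = q^-≢ e n (n≢e ∘ cong suc)

factor-q^ : ∀ s k m → factor (q^ s) k m ≗ 𝟙 ⊖ q^ (s + k * m)
factor-q^ s k m n = cong (ℤ._-_ (𝟙 n)) (q^-⊗ s (k * m) n)

∏-cong : ∀ M {F G} → (∀ m → F m ≗ G m) → ∏ M F ≗ ∏ M G
∏-cong zero    F≗G = ≗-refl
∏-cong (suc M) F≗G = ⊗-cong (F≗G M) (∏-cong M F≗G)

∏-suc : ∀ M F → ∏ (suc M) F ≗ F 0 ⊗ ∏ M (F ∘ suc)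
∏-suc zero    F = ≗-refl
∏-suc (suc M) F = ≗-trans (⊗-congˡ (F (suc M)) (∏-suc M F))
  (solve 3 (λ x y z → x :* (y :* z) := y :* (x :* z)) ≗-refl (F (suc M)) (F 0) (∏ M (F ∘ suc)))
  where open SeriesSolver

∏-⊗ : ∀ M F G → ∏ M (λ m → F m ⊗ G m) ≗ ∏ M F ⊗ ∏ M G
∏-⊗ zero    F G = ≗-sym (⊗-identityˡ 𝟙)
∏-⊗ (suc M) F G = ≗-trans (⊗-congˡ (F M ⊗ G M) (∏-⊗ M F G))
  (solve 4 (λ x y u v → x :* y :* (u :* v) := x :* u :* (y :* v)) ≗-refl
    (F M) (G M) (∏ M F) (∏ M G))
  where open SeriesSolver

∏-pairs : ∀ M F → ∏ (M * 2) F ≗ ∏ M (λ m → F (m * 2) ⊗ F (suc (m * 2)))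
∏-pairs zero    F = ≗-refl
∏-pairs (suc M) F = ≗-trans (⊗-congˡ (F (suc (M * 2))) (⊗-congˡ (F (M * 2)) (∏-pairs M F)))
  (solve 3 (λ x y z → y :* (x :* z) := x :* y :* z) ≗-refl
    (F (M * 2)) (F (suc (M * 2))) (∏ M (λ m → F (m * 2) ⊗ F (suc (m * 2)))))
  where open SeriesSolver

poch≈∏ : ∀ a k M → a 0 ≡ 0ℤ → 1 ≤ k → ⟨ a ,q^ k ⟩∞ ≈[ suc M ] ∏ M (factor a k)
poch≈∏ a k M a₀≡0 1≤k n (s≤s n≤M) = sym (poch-limit a k n M a₀≡0 1≤k n≤M)

poch-q^≈∏ : ∀ s k M → 1 ≤ s → 1 ≤ k → ⟨ q^ s ,q^ k ⟩∞ ≈[ suc M ] ∏ M (factor (q^ s) k)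
poch-q^≈∏ s k M 1≤s = poch≈∏ (q^ s) k M (q^-below s 0 1≤s)

-- The coefficient is read off from `suc n` factors on the left, so that `n` of them, enough for the
-- right, remain once the first is split off.
poch-q^-suc : ∀ s k → 1 ≤ s → 1 ≤ k →
              ⟨ q^ s ,q^ k ⟩∞ ≗ (𝟙 ⊖ q^ s) ⊗ ⟨ q^ (s + k) ,q^ k ⟩∞
poch-q^-suc s k 1≤s 1≤k n = begin
  ⟨ q^ s ,q^ k ⟩∞ n                                 ≡⟨ poch-q^≈∏ s k (suc n) 1≤s 1≤k n (m<n⇒m<1+n (n<1+n n)) ⟩
  ∏ (suc n) (factor (q^ s) k) n                     ≡⟨ ∏-suc n (factor (q^ s) k) n ⟩
  (factor (q^ s) k 0 ⊗ ∏ n (factor (q^ s) k ∘ suc)) n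
    ≡⟨ ⊗-cong head (∏-cong n shift) n ⟩
  ((𝟙 ⊖ q^ s) ⊗ ∏ n (factor (q^ (s + k)) k)) n
    ≡⟨ ≈-⊗ˡ (𝟙 ⊖ q^ s) (poch-q^≈∏ (s + k) k n (≤-trans 1≤s (m≤m+n s k)) 1≤k) n (n<1+n n) ⟨
  ((𝟙 ⊖ q^ s) ⊗ ⟨ q^ (s + k) ,q^ k ⟩∞) n            ∎
  where
  open ≡-Reasoning
  head : factor (q^ s) k 0 ≗ 𝟙 ⊖ q^ s
  head m = trans (factor-q^ s k 0 m) (cong (λ e → (𝟙 ⊖ q^ e) m) (exponent s k))
    where
    exponent : ∀ s k → s + k * 0 ≡ s
    exponent = solve-∀
  shift : ∀ m → factor (q^ s) k (suc m) ≗ factor (q^ (s + k)) k m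
  shift m l = trans (factor-q^ s k (suc m) l) (trans
    (cong (λ e → (𝟙 ⊖ q^ e) l) (exponent s k m)) (sym (factor-q^ (s + k) k m l)))
    where
    exponent : ∀ s k m → s + k * suc m ≡ s + k + k * m
    exponent = solve-∀

poch-q^≈𝟙 : ∀ s k → ⟨ q^ s ,q^ k ⟩∞ ≈[ s ] 𝟙
poch-q^≈𝟙 s k n = finite n n
  where
  factor≈𝟙 : ∀ m → factor (q^ s) k m ≈[ s ] 𝟙
  factor≈𝟙 m n n<s = trans (factor-q^ s k m n) (trans
    (cong (ℤ._-_ (𝟙 n)) (q^-below (s + k * m) n (<-≤-trans n<s (m≤m+n s (k * m)))))
    (ℤ.+-identityʳ (𝟙 n)))
  finite : ∀ M → ∏ M (factor (q^ s) k) ≈[ s ] 𝟙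
  finite zero    = λ _ _ → refl
  finite (suc M) = λ n n<s → trans
    (≈-⊗ (factor≈𝟙 M) (finite M) n n<s) (⊗-identityˡ 𝟙 n)

-- The Jacobi triple product

q^*0-⊗ : ∀ k f → q^ (k * 0) ⊗ f ≗ f
q^*0-⊗ k f rewrite *-zeroʳ k = ≗-trans (⊗-congʳ f q^0≗𝟙) (⊗-identityˡ f)

q^-+ : ∀ a b f → q^ (a + b) ⊗ f ≗ q^ a ⊗ (q^ b ⊗ f)
q^-+ a b f = ≗-trans (⊗-congʳ f (≗-sym (q^-⊗ a b))) (⊗-assoc (q^ a) (q^ b) f)

q^-swap : ∀ a b c d f → a + b ≡ c + d → q^ a ⊗ (q^ b ⊗ f) ≗ q^ c ⊗ (q^ d ⊗ f)
q^-swap a b c d f eq = ≗-trans (≗-sym (q^-+ a b f))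
  (≗-trans (λ n → cong (λ e → (q^ e ⊗ f) n) eq) (q^-+ c d f))

⊝-cong : ∀ {f g} → f ≗ g → ⊝ f ≗ ⊝ g
⊝-cong f≗g n = cong ℤ.-_ (f≗g n)

⊗-⊝ʳ : ∀ f g → f ⊗ ⊝ g ≗ ⊝ (f ⊗ g)
⊗-⊝ʳ = solve 2 (λ f g → f :* :- g := :- (f :* g)) ≗-refl
  where open SeriesSolver

𝟙⊖-⊗ : ∀ f g → (𝟙 ⊖ f) ⊗ g ≗ g ⊖ f ⊗ g
𝟙⊖-⊗ f g = ≗-trans
  (solve 3 (λ u f g → (u :- f) :* g := u :* g :- f :* g) ≗-refl 𝟙 f g)
  (λ n → cong (ℤ._- (f ⊗ g) n) (⊗-identityˡ g n))
  where open SeriesSolver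

⊗-orderˡ : ∀ {N} f g → f ≈[ N ] 𝟘 → f ⊗ g ≈[ N ] 𝟘
⊗-orderˡ f g f≈𝟘 n n<N = trans (≈-⊗ʳ g f≈𝟘 n n<N) (⊗-zeroˡ g n)

q^-order : ∀ a f → q^ a ⊗ f ≈[ a ] 𝟘
q^-order a f = ⊗-orderˡ (q^ a) f (q^-below a)

module TailSum (k : ℕ) (1≤k : 1 ≤ k) where

  V : ℕ → Series
  V r = ⟨ q^ (k * suc r) ,q^ k ⟩∞

  1≤k*suc : ∀ r → 1 ≤ k * suc r
  1≤k*suc r = *-mono-≤ 1≤k (s≤s (z≤n {r}))

  V-suc : ∀ r → V r ≗ (𝟙 ⊖ q^ (k * suc r)) ⊗ V (suc r)
  V-suc r = subst (λ e → V r ≗ (𝟙 ⊖ q^ (k * suc r)) ⊗ ⟨ q^ e ,q^ k ⟩∞) (exponent k r)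
    (poch-q^-suc (k * suc r) k (1≤k*suc r) 1≤k)
    where
    exponent : ∀ k r → k * suc r + k ≡ k * suc (suc r)
    exponent = solve-∀

  -- With Q = q^k and `V r` = (Q^(r+1);Q)_∞, this is the shape of the right-hand side in the
  -- induction on b, cut off after R terms; the index r stands for b + m.
  T : ℕ → (ℕ → Series) → Series
  T zero    σ = 𝟘
  T (suc R) σ = T R σ ⊕ σ R ⊗ V R

  T-cong : ∀ R {σ τ} → (∀ r → σ r ≗ τ r) → T R σ ≗ T R τ
  T-cong zero    σ≗τ n = refl
  T-cong (suc R) σ≗τ n = cong₂ ℤ._+_ (T-cong R σ≗τ n) (⊗-congʳ (V R) (σ≗τ R) n)

  T-⊝⊗ : ∀ R x σ → T R (λ r → ⊝ (x ⊗ σ r)) ≗ ⊝ (x ⊗ T R σ)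
  T-⊝⊗ zero    x σ n = sym (cong ℤ.-_ (trans (⊗-comm x 𝟘 n) (⊗-zeroˡ x n)))
  T-⊝⊗ (suc R) x σ = ≗-trans (λ n → cong (ℤ._+ (⊝ (x ⊗ σ R) ⊗ V R) n) (T-⊝⊗ R x σ n))
    (solve 4 (λ x y s v → :- (x :* y) :+ :- (x :* s) :* v := :- (x :* (y :+ s :* v))) ≗-refl
      x (T R σ) (σ R) (V R))
    where open SeriesSolver

  -- For r ≥ 1, `V-suc` gives V_r = V_(r-1) + Q^r V_r, which splits every term in two. The term r =
  -- 0 goes entirely into the second sum, where Q^0 = 1.
  T-split : ∀ R σ → T (suc R) σ ≗ T R (σ ∘ suc) ⊕ T (suc R) (λ r → q^ (k * r) ⊗ σ r)
  T-split zero σ n = cong (ℤ._+_ 0ℤ) (trans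
    (⊗-congʳ (V 0) (≗-sym (q^*0-⊗ k (σ 0))) n) (sym (ℤ.+-identityˡ _)))
  T-split (suc R) σ = ≗-trans
    (λ n → cong (ℤ._+ (x ⊗ v) n) (T-split R σ n))
    (≗-trans
      (solve 5 (λ a b x y v → a :+ b :+ x :* v := a :+ x :* (v :- y :* v) :+ (b :+ y :* x :* v)) ≗-refl
        a b x y v)
      λ n → cong (λ c → a n ℤ.+ c ℤ.+ (b n ℤ.+ (y ⊗ x ⊗ v) n))
        (⊗-congˡ x (≗-sym (≗-trans (V-suc R) (𝟙⊖-⊗ y v))) n))
    where
    open SeriesSolver
    a b x y v : Series
    a = T R (σ ∘ suc)
    b = T (suc R) (λ r → q^ (k * r) ⊗ σ r)
    x = σ (suc R)
    y = q^ (k * suc R)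
    v = V (suc R)

  -- The last term of the second sum carries the factor q^(kR) and vanishes modulo q^R, so both sums
  -- can be cut off at the same place.
  T-step : ∀ R σ → T (suc R) σ ≈[ R ] T R (σ ∘ suc) ⊕ T R (λ r → q^ (k * r) ⊗ σ r)
  T-step R σ n n<R = trans (T-split R σ n) (cong (ℤ._+_ (T R (σ ∘ suc) n)) (trans
    (cong (ℤ._+_ (T R (λ r → q^ (k * r) ⊗ σ r) n))
      (⊗-orderˡ (q^ (k * R) ⊗ σ R) (V R)
        (≈-weaken (m≤n*m R k {{>-nonZero 1≤k}}) (q^-order (k * R) (σ R))) n n<R))
    (ℤ.+-identityʳ _)))

  -- The pattern of F(z) = (1 - z) F(zQ): scaling by Q^r yields the new sequence, and shifting
  -- yields the same one times -x.
  T-step-⊝⊗ : ∀ R x σ τ → (∀ r → σ (suc r) ≗ ⊝ (x ⊗ τ r)) → (∀ r → q^ (k * r) ⊗ σ r ≗ τ r) →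
              T (suc R) σ ≈[ R ] (𝟙 ⊖ x) ⊗ T R τ
  T-step-⊝⊗ R x σ τ tail≗ scaled≗ n n<R = begin
    T (suc R) σ n                                                ≡⟨ T-step R σ n n<R ⟩
    T R (σ ∘ suc) n ℤ.+ T R (λ r → q^ (k * r) ⊗ σ r) n
      ≡⟨ cong₂ ℤ._+_ (trans (T-cong R tail≗ n) (T-⊝⊗ R x τ n)) (T-cong R scaled≗ n) ⟩
    ℤ.- (x ⊗ T R τ) n ℤ.+ T R τ n                                ≡⟨ ℤ.+-comm (ℤ.- (x ⊗ T R τ) n) (T R τ n) ⟩
    (T R τ ⊖ x ⊗ T R τ) n                                        ≡⟨ 𝟙⊖-⊗ x (T R τ) n ⟨
    ((𝟙 ⊖ x) ⊗ T R τ) n                                          ∎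
    where open ≡-Reasoning

  -- The pattern of the step from b to b + 1, with the roles of shifting and scaling exchanged.
  T-step-⊗⊝ : ∀ R x σ τ → (∀ r → σ (suc r) ≗ τ r) → (∀ r → q^ (k * r) ⊗ σ r ≗ ⊝ (x ⊗ τ r)) →
              T (suc R) σ ≈[ R ] (𝟙 ⊖ x) ⊗ T R τ
  T-step-⊗⊝ R x σ τ tail≗ scaled≗ n n<R = begin
    T (suc R) σ n                                                ≡⟨ T-step R σ n n<R ⟩
    T R (σ ∘ suc) n ℤ.+ T R (λ r → q^ (k * r) ⊗ σ r) n
      ≡⟨ cong₂ ℤ._+_ (T-cong R tail≗ n) (trans (T-cong R scaled≗ n) (T-⊝⊗ R x τ n)) ⟩
    (T R τ ⊖ x ⊗ T R τ) n                                        ≡⟨ 𝟙⊖-⊗ x (T R τ) n ⟨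
    ((𝟙 ⊖ x) ⊗ T R τ) n                                          ∎
    where open ≡-Reasoning

-- With z = q^s this is θ_r for r ≥ 0. Negative indices are covered by `θ k t`: since z w = Q, the
-- term θ_(-r) equals (-1)^r w^r Q^(r(r-1)/2).
θ : ℕ → ℕ → ℕ → Series
θ k s zero    = 𝟙
θ k s (suc r) = ⊝ (q^ (s + k * r) ⊗ θ k s r)

-- Multiplication by Q^r amounts to replacing z by zQ in z^r.
q^⊗θ : ∀ k s r → q^ (k * r) ⊗ θ k s r ≗ θ k (s + k) r
q^⊗θ k s zero    = q^*0-⊗ k 𝟙
q^⊗θ k s (suc r) = begin
  q^ (k * suc r) ⊗ ⊝ (q^ (s + k * r) ⊗ θ k s r)     ≈⟨ ⊗-⊝ʳ (q^ (k * suc r)) (q^ (s + k * r) ⊗ θ k s r) ⟩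
  ⊝ (q^ (k * suc r) ⊗ (q^ (s + k * r) ⊗ θ k s r))   ≈⟨ ⊝-cong (q^-swap (k * suc r) (s + k * r) (s + k + k * r) (k * r) (θ k s r) (exponents k s r)) ⟩
  ⊝ (q^ (s + k + k * r) ⊗ (q^ (k * r) ⊗ θ k s r))   ≈⟨ ⊝-cong (⊗-congˡ (q^ (s + k + k * r)) (q^⊗θ k s r)) ⟩
  ⊝ (q^ (s + k + k * r) ⊗ θ k (s + k) r)            ∎
  where
  open SetoidReasoning setoid
  exponents : ∀ k s r → k * suc r + (s + k * r) ≡ s + k + k * r + k * r
  exponents = solve-∀

θ-suc : ∀ k s r → θ k s (suc r) ≗ ⊝ (q^ s ⊗ θ k (s + k) r)
θ-suc k s r = ⊝-cong (≗-trans (q^-+ s (k * r) (θ k s r)) (⊗-congˡ (q^ s) (q^⊗θ k s r)))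

-- exponent k s r = s r + k r(r-1)/2, and θ k s r = (-1)^r q^(exponent k s r).
exponent : ℕ → ℕ → ℕ → ℕ
exponent k s zero    = 0
exponent k s (suc r) = (s + k * r) + exponent k s r

-- Up to sign, `θ k s r` is a single power of q. The sign is irrelevant for the support, so a
-- disjunction replaces tracking the parity of r.
θ-support : ∀ k s r n → n ≢ exponent k s r → θ k s r n ≡ 0ℤ
θ-support k s r n n≢e with θ≗±q^ r
  where
  θ≗±q^ : ∀ r → (θ k s r ≗ q^ exponent k s r) ⊎ (θ k s r ≗ ⊝ q^ exponent k s r)
  θ≗±q^ zero = inj₁ (≗-sym q^0≗𝟙)
  θ≗±q^ (suc r) with θ≗±q^ r
  ... | inj₁ θ≗ = inj₂ (⊝-cong (≗-trans (⊗-congˡ (q^ (s + k * r)) θ≗) (q^-⊗ (s + k * r) (exponent k s r))))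
  ... | inj₂ θ≗ = inj₁ (≗-trans
    (⊝-cong (≗-trans (⊗-congˡ (q^ (s + k * r)) θ≗) (⊗-⊝ʳ (q^ (s + k * r)) (q^ exponent k s r))))
    (λ n → trans (ℤ.neg-involutive _) (q^-⊗ (s + k * r) (exponent k s r) n)))
... | inj₁ θ≗ = trans (θ≗ n) (q^-≢ (exponent k s r) n n≢e)
... | inj₂ θ≗ = trans (θ≗ n) (cong ℤ.-_ (q^-≢ (exponent k s r) n n≢e))

module JacobiTriple (k s t : ℕ) (1≤s : 1 ≤ s) (1≤t : 1 ≤ t) (s+t≡k : s + t ≡ k) where

  1≤k : 1 ≤ k
  1≤k = ≤-trans 1≤s (≤-trans (m≤m+n s t) (≤-reflexive s+t≡k))

  open TailSum k 1≤k

  T-θ-step : ∀ R s → T (suc R) (θ k s) ≈[ R ] (𝟙 ⊖ q^ s) ⊗ T R (θ k (s + k))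
  T-θ-step R s = T-step-⊝⊗ R (q^ s) (θ k s) (θ k (s + k)) (θ-suc k s) (q^⊗θ k s)

  -- ψ b r is the term of index m = r - b ∈ ℤ of the bilateral theta series.
  ψ : ℕ → ℕ → Series
  ψ zero    r       = θ k s r
  ψ (suc b) zero    = θ k t (suc b)
  ψ (suc b) (suc r) = ψ b r

  ψ-zero : ∀ b → ψ b 0 ≡ θ k t b
  ψ-zero zero    = refl
  ψ-zero (suc b) = refl

  -- With m = r - b this is θ_(m+1) = -z Q^m θ_m multiplied by w Q^b, where z w = Q. The relation z
  -- w = Q is used at b = 0; the leftmost term follows from the recursion of `θ k t`, and the
  -- remaining cases by lowering b and r together.
  q^⊗ψ : ∀ b r → q^ (k * suc r) ⊗ ψ b r ≗ ⊝ (q^ (t + k * b) ⊗ ψ b (suc r))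
  q^⊗ψ zero r = ≗-sym (begin
    ⊝ (q^ (t + k * 0) ⊗ ⊝ (q^ (s + k * r) ⊗ θ k s r))
      ≈⟨ ⊝-cong (⊗-⊝ʳ (q^ (t + k * 0)) (q^ (s + k * r) ⊗ θ k s r)) ⟩
    ⊝ ⊝ (q^ (t + k * 0) ⊗ (q^ (s + k * r) ⊗ θ k s r))
      ≈⟨ (λ n → ℤ.neg-involutive _) ⟩
    q^ (t + k * 0) ⊗ (q^ (s + k * r) ⊗ θ k s r)
      ≈⟨ q^-+ (t + k * 0) (s + k * r) (θ k s r) ⟨
    q^ (t + k * 0 + (s + k * r)) ⊗ θ k s r
      ≡⟨ cong (λ e → q^ e ⊗ θ k s r) (trans (exponents k s t r) (trans (cong (λ l → l + k * r) s+t≡k) (sym (*-suc k r)))) ⟩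
    q^ (k * suc r) ⊗ θ k s r ∎)
    where
    open SetoidReasoning setoid
    exponents : ∀ k s t r → t + k * 0 + (s + k * r) ≡ s + t + k * r
    exponents = solve-∀
  q^⊗ψ (suc b) zero rewrite ψ-zero b = begin
    q^ (k * 1) ⊗ ⊝ (q^ (t + k * b) ⊗ θ k t b)   ≈⟨ ⊗-⊝ʳ (q^ (k * 1)) (q^ (t + k * b) ⊗ θ k t b) ⟩
    ⊝ (q^ (k * 1) ⊗ (q^ (t + k * b) ⊗ θ k t b)) ≈⟨ ⊝-cong (q^-+ (k * 1) (t + k * b) (θ k t b)) ⟨
    ⊝ (q^ (k * 1 + (t + k * b)) ⊗ θ k t b)      ≡⟨ cong (λ e → ⊝ (q^ e ⊗ θ k t b)) (exponents k t b) ⟩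
    ⊝ (q^ (t + k * suc b) ⊗ θ k t b)            ∎
    where
    open SetoidReasoning setoid
    exponents : ∀ k t b → k * 1 + (t + k * b) ≡ t + k * suc b
    exponents = solve-∀
  q^⊗ψ (suc b) (suc r) = begin
    q^ (k * suc (suc r)) ⊗ ψ b r                       ≡⟨ cong (λ e → q^ e ⊗ ψ b r) (*-suc k (suc r)) ⟩
    q^ (k + k * suc r) ⊗ ψ b r                         ≈⟨ q^-+ k (k * suc r) (ψ b r) ⟩
    q^ k ⊗ (q^ (k * suc r) ⊗ ψ b r)                    ≈⟨ ⊗-congˡ (q^ k) (q^⊗ψ b r) ⟩
    q^ k ⊗ ⊝ (q^ (t + k * b) ⊗ ψ b (suc r))            ≈⟨ ⊗-⊝ʳ (q^ k) (q^ (t + k * b) ⊗ ψ b (suc r)) ⟩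
    ⊝ (q^ k ⊗ (q^ (t + k * b) ⊗ ψ b (suc r)))          ≈⟨ ⊝-cong (q^-+ k (t + k * b) (ψ b (suc r))) ⟨
    ⊝ (q^ (k + (t + k * b)) ⊗ ψ b (suc r))
      ≡⟨ cong (λ e → ⊝ (q^ e ⊗ ψ b (suc r))) (exponents k t b) ⟩
    ⊝ (q^ (t + k * suc b) ⊗ ψ b (suc r))               ∎
    where
    open SetoidReasoning setoid
    exponents : ∀ k t b → k + (t + k * b) ≡ t + k * suc b
    exponents = solve-∀

  -- Raising b shifts the sequence by one place, so this is `q^⊗ψ` at r - 1; at r = 0 it is the
  -- defining recursion of `θ k t`.
  q^⊗ψ-suc : ∀ b r → q^ (k * r) ⊗ ψ (suc b) r ≗ ⊝ (q^ (t + k * b) ⊗ ψ b r)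
  q^⊗ψ-suc b zero rewrite ψ-zero b = q^*0-⊗ k (θ k t (suc b))
  q^⊗ψ-suc b (suc r) = q^⊗ψ b r

  T-ψ-step : ∀ R b → T (suc R) (ψ (suc b)) ≈[ R ] (𝟙 ⊖ q^ (t + k * b)) ⊗ T R (ψ b)
  T-ψ-step R b = T-step-⊗⊝ R (q^ (t + k * b)) (ψ (suc b)) (ψ b) (λ _ _ → refl) (q^⊗ψ-suc b)

  -- N applications of F(z) = (1 - z) F(zQ). Each of them uses up one term of the truncated sum,
  -- hence the cut-off N + R.
  T-θ-iterate : ∀ N R → T (N + R) (θ k s) ≈[ R ] ∏ N (factor (q^ s) k) ⊗ T R (θ k (s + k * N))
  T-θ-iterate zero R n _ = trans
    (cong (λ e → T R (θ k e) n) (exponents k s)) (sym (⊗-identityˡ (T R (θ k (s + k * 0))) n))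
    where
    exponents : ∀ k s → s ≡ s + k * 0
    exponents = solve-∀
  T-θ-iterate (suc N) R = begin
    T (suc N + R) (θ k s)                                      ≡⟨ cong (λ M → T M (θ k s)) (+-suc N R) ⟨
    T (N + suc R) (θ k s)                                      ≈⟨ ≈-weaken (n≤1+n R) (T-θ-iterate N (suc R)) ⟩
    P ⊗ T (suc R) (θ k (s + k * N))                            ≈⟨ ≈-⊗ˡ P (T-θ-step R (s + k * N)) ⟩
    P ⊗ ((𝟙 ⊖ q^ (s + k * N)) ⊗ T R (θ k (s + k * N + k)))
      ≡⟨ cong (λ e → P ⊗ ((𝟙 ⊖ q^ (s + k * N)) ⊗ T R (θ k e))) (exponents k s N) ⟩
    P ⊗ ((𝟙 ⊖ q^ (s + k * N)) ⊗ U)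
      ≈⟨ ≗⇒≈ (⊗-congˡ P (⊗-congʳ U (≗-sym (factor-q^ s k N)))) ⟩
    P ⊗ (factor (q^ s) k N ⊗ U)
      ≈⟨ ≗⇒≈ (solve 3 (λ p x u → p :* (x :* u) := x :* p :* u) ≗-refl P (factor (q^ s) k N) U) ⟩
    factor (q^ s) k N ⊗ P ⊗ U                                  ∎
    where
    open SetoidReasoning (truncated R)
    open SeriesSolver
    P U : Series
    P = ∏ N (factor (q^ s) k)
    U = T R (θ k (s + k * suc N))
    exponents : ∀ k s N → s + k * N + k ≡ s + k * suc N
    exponents = solve-∀

  T-ψ-iterate : ∀ N R → T (N + R) (ψ N) ≈[ R ] ∏ N (factor (q^ t) k) ⊗ T R (θ k s)
  T-ψ-iterate zero    R n _ = sym (⊗-identityˡ (T R (θ k s)) n)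
  T-ψ-iterate (suc N) R = begin
    T (suc N + R) (ψ (suc N))                          ≈⟨ ≈-weaken (m≤n+m R N) (T-ψ-step (N + R) N) ⟩
    (𝟙 ⊖ q^ (t + k * N)) ⊗ T (N + R) (ψ N)             ≈⟨ ≈-⊗ (≗⇒≈ (≗-sym (factor-q^ t k N))) (T-ψ-iterate N R) ⟩
    factor (q^ t) k N ⊗ (∏ N (factor (q^ t) k) ⊗ T R (θ k s))
      ≈⟨ ≗⇒≈ (⊗-assoc (factor (q^ t) k N) (∏ N (factor (q^ t) k)) (T R (θ k s))) ⟨
    factor (q^ t) k N ⊗ ∏ N (factor (q^ t) k) ⊗ T R (θ k s) ∎
    where open SetoidReasoning (truncated R)

  -- All terms with r ≥ 1 are divisible by z = q^s. For F(zQ^N) with N large, this leaves only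
  -- (Q)_∞.
  T-θ-low : ∀ R s → T (suc R) (θ k s) ≈[ s ] V 0
  T-θ-low zero    s n _   = trans (ℤ.+-identityˡ _) (⊗-identityˡ (V 0) n)
  T-θ-low (suc R) s n n<s = trans
    (cong₂ ℤ._+_ (T-θ-low R s n n<s)
      (⊗-orderˡ (θ k s (suc R)) (V (suc R)) θ≈𝟘 n n<s))
    (ℤ.+-identityʳ (V 0 n))
    where
    θ≈𝟘 : θ k s (suc R) ≈[ s ] 𝟘
    θ≈𝟘 m m<s = trans (θ-suc k s R m) (cong ℤ.-_ (q^-order s (θ k (s + k) R) m m<s))

  triple : Series
  triple = ⟨ q^ s ,q^ k ⟩∞ ⊗ ⟨ q^ t ,q^ k ⟩∞ ⊗ ⟨ q^ k ,q^ k ⟩∞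

  -- Of the N + (N + suc N) terms, N are spent on descending from b = N to b = 0, N on the
  -- functional equation, and `suc N` give the final precision.
  T-ψ≈triple : ∀ N → T (N + (N + suc N)) (ψ N) ≈[ suc N ] triple
  T-ψ≈triple N = begin
    T (N + (N + suc N)) (ψ N)                       ≈⟨ ≈-weaken (m≤n+m (suc N) N) (T-ψ-iterate N (N + suc N)) ⟩
    ∏ N (factor (q^ t) k) ⊗ T (N + suc N) (θ k s)   ≈⟨ ≈-⊗ˡ (∏ N (factor (q^ t) k)) (T-θ-iterate N (suc N)) ⟩
    ∏ N (factor (q^ t) k) ⊗ (∏ N (factor (q^ s) k) ⊗ T (suc N) (θ k (s + k * N)))
      ≈⟨ ≈-⊗ (poch-sym t 1≤t) (≈-⊗ (poch-sym s 1≤s) (≈-weaken N<s+kN (T-θ-low N (s + k * N)))) ⟩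
    ⟨ q^ t ,q^ k ⟩∞ ⊗ (⟨ q^ s ,q^ k ⟩∞ ⊗ V 0)
      ≡⟨ cong (λ e → ⟨ q^ t ,q^ k ⟩∞ ⊗ (⟨ q^ s ,q^ k ⟩∞ ⊗ ⟨ q^ e ,q^ k ⟩∞)) (*-identityʳ k) ⟩
    ⟨ q^ t ,q^ k ⟩∞ ⊗ (⟨ q^ s ,q^ k ⟩∞ ⊗ ⟨ q^ k ,q^ k ⟩∞)
      ≈⟨ ≗⇒≈ (solve 3 (λ x y z → x :* (y :* z) := y :* x :* z) ≗-refl ⟨ q^ t ,q^ k ⟩∞ ⟨ q^ s ,q^ k ⟩∞ ⟨ q^ k ,q^ k ⟩∞) ⟩
    triple ∎
    where
    open SetoidReasoning (truncated (suc N))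
    open SeriesSolver
    poch-sym : ∀ a → 1 ≤ a → ∏ N (factor (q^ a) k) ≈[ suc N ] ⟨ q^ a ,q^ k ⟩∞
    poch-sym a 1≤a n n<1+N = sym (poch-q^≈∏ a k N 1≤a 1≤k n n<1+N)
    N<s+kN : suc N ≤ s + k * N
    N<s+kN = +-mono-≤ 1≤s (m≤n*m N k {{>-nonZero 1≤k}})

  θ-order : ∀ b → θ k t b ≈[ b ] 𝟘
  θ-order (suc b) n n<1+b = cong ℤ.-_
    (q^-order (t + k * b) (θ k t b) n (<-≤-trans n<1+b (+-mono-≤ 1≤t (m≤n*m b k {{>-nonZero 1≤k}}))))

  ψ-order : ∀ b r → ψ b r ≈[ b ∸ r ] 𝟘
  ψ-order zero    zero    _ ()
  ψ-order zero    (suc r) _ ()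
  ψ-order (suc b) zero    = θ-order (suc b)
  ψ-order (suc b) (suc r) = ψ-order b r

  -- `ψ N r` has order at least N - r and V_r - 1 has order at least r + 1, so the error has order
  -- at least N + 1. Hence the tails V_r do not affect the coefficients up to q^N, and a plain theta
  -- series remains.
  ψ⊗V : ∀ N r → ψ N r ⊗ V r ≈[ suc N ] ψ N r
  ψ⊗V N r n n<1+N = begin
    (ψ N r ⊗ V r) n                              ≡⟨ split n ⟩
    (ψ N r ⊗ (V r ⊖ 𝟙)) n ℤ.+ (ψ N r ⊗ 𝟙) n
      ≡⟨ cong₂ ℤ._+_ (⊗-order (ψ N r) (V r ⊖ 𝟙) (ψ-order N r) V⊖𝟙≈𝟘 n (<-≤-trans n<1+N bound))
           (trans (⊗-comm (ψ N r) 𝟙 n) (⊗-identityˡ (ψ N r) n)) ⟩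
    0ℤ ℤ.+ ψ N r n                               ≡⟨ ℤ.+-identityˡ (ψ N r n) ⟩
    ψ N r n                                      ∎
    where
    open ≡-Reasoning
    split : ψ N r ⊗ V r ≗ ψ N r ⊗ (V r ⊖ 𝟙) ⊕ ψ N r ⊗ 𝟙
    split = solve 3 (λ x v u → x :* v := x :* (v :- u) :+ x :* u) ≗-refl (ψ N r) (V r) 𝟙
      where open SeriesSolver
    V⊖𝟙≈𝟘 : V r ⊖ 𝟙 ≈[ suc r ] 𝟘
    V⊖𝟙≈𝟘 m m<1+r = trans
      (cong (ℤ._- 𝟙 m) (poch-q^≈𝟙 (k * suc r) k m (<-≤-trans m<1+r (m≤n*m (suc r) k {{>-nonZero 1≤k}}))))
      (ℤ.+-inverseʳ (𝟙 m))
    bound : suc N ≤ N ∸ r + suc r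
    bound = ≤-trans (s≤s (≤-trans (m≤n+m∸n N r) (≤-reflexive (+-comm r (N ∸ r))))) (≤-reflexive (sym (+-suc (N ∸ r) r)))

  ψ-support : ∀ b r n → (∀ m → n ≢ exponent k s m) → (∀ m → n ≢ exponent k t m) → ψ b r n ≡ 0ℤ
  ψ-support zero    r       n ≢s ≢t = θ-support k s r n (≢s r)
  ψ-support (suc b) zero    n ≢s ≢t = θ-support k t (suc b) n (≢t (suc b))
  ψ-support (suc b) (suc r) n ≢s ≢t = ψ-support b r n ≢s ≢t

  triple-support : ∀ n → (∀ m → n ≢ exponent k s m) → (∀ m → n ≢ exponent k t m) → triple n ≡ 0ℤ
  triple-support n ≢s ≢t =
    -- Taking N = n suffices, since the approximation is exact up to and including q^N.
    trans (sym (T-ψ≈triple n n (n<1+n n))) (T-support (n + (n + suc n)))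
    where
    T-support : ∀ R → T R (ψ n) n ≡ 0ℤ
    T-support zero    = refl
    T-support (suc R) = cong₂ ℤ._+_ (T-support R)
      (trans (ψ⊗V n R n (n<1+n n)) (ψ-support n R n ≢s ≢t))

-- Reduction modulo 4

∣-⊗ : ∀ {c d} f g → (∀ n → c ∣ f n) → (∀ n → d ∣ g n) → ∀ n → c ℤ.* d ∣ (f ⊗ g) n
∣-⊗ {c} {d} f g c∣f d∣g = go f c∣f
  where
  term : ∀ x y → c ∣ x → d ∣ y → c ℤ.* d ∣ x ℤ.* y
  term x y c∣x d∣y = ∣-trans (*-monoʳ-∣ c d∣y) (*-monoˡ-∣ y c∣x)
  go : ∀ f → (∀ n → c ∣ f n) → ∀ n → c ℤ.* d ∣ (f ⊗ g) n
  go f c∣f zero    = ∣-trans (term (f 0) (g 0) (c∣f 0) (d∣g 0)) (∣-reflexive (sym (ℤ.+-identityʳ _)))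
  go f c∣f (suc n) = ∣m∣n⇒∣m+n (term (f 0) (g (suc n)) (c∣f 0) (d∣g (suc n))) (go (tail f) (c∣f ∘ suc) n)

1∣ : ∀ x → 1ℤ ∣ x
1∣ x = divides x (sym (ℤ.*-identityʳ x))

∣-⊗ˡ : ∀ {c} f g → (∀ n → c ∣ f n) → ∀ n → c ∣ (f ⊗ g) n
∣-⊗ˡ {c} f g c∣f n =
  subst (_∣ (f ⊗ g) n) (ℤ.*-identityʳ c) (∣-⊗ f g c∣f (λ m → 1∣ (g m)) n)

∣-⊗ʳ : ∀ {c} f g → (∀ n → c ∣ g n) → ∀ n → c ∣ (f ⊗ g) n
∣-⊗ʳ {c} f g c∣g n =
  subst (_∣ (f ⊗ g) n) (ℤ.*-identityˡ c) (∣-⊗ f g (λ m → 1∣ (f m)) c∣g n)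

-- As `f` has constant term 1, the coefficients of `g` are recovered from those of the product one
-- at a time, integrally.
∣-cancelʳ : ∀ {c} f g → f 0 ≡ 1ℤ → (∀ n → c ∣ (g ⊗ f) n) → ∀ n → c ∣ g n
∣-cancelʳ {c} f g f₀≡1 c∣gf = go g c∣gf
  where
  head : ∀ g → c ∣ (g ⊗ f) 0 → c ∣ g 0
  head g = subst (c ∣_) (trans (ℤ.+-identityʳ _) (trans (cong (g 0 ℤ.*_) f₀≡1) (ℤ.*-identityʳ (g 0))))
  go : ∀ g → (∀ n → c ∣ (g ⊗ f) n) → ∀ n → c ∣ g n
  go g c∣gf zero    = head g (c∣gf 0)
  go g c∣gf (suc n) = go (tail g)
    (λ m → ∣m+n∣m⇒∣n (c∣gf (suc m)) (∣m⇒∣m*n (f (suc m)) (head g (c∣gf 0)))) n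

-- Equality is divisibility of the difference by 0, so this is `∣-cancelʳ` with c = 0.
⊗-cancelʳ : ∀ f g h → f 0 ≡ 1ℤ → g ⊗ f ≗ h ⊗ f → g ≗ h
⊗-cancelʳ f g h f₀≡1 gf≗hf n = ℤ.i-j≡0⇒i≡j (g n) (h n)
  (0∣⇒≡0 (∣-cancelʳ f (g ⊖ h) f₀≡1 (λ m → ∣-reflexive (sym (difference m))) n))
  where
  difference : (g ⊖ h) ⊗ f ≗ 𝟘
  difference m = trans
    (solve 3 (λ g h f → (g :- h) :* f := g :* f :- h :* f) ≗-refl g h f m)
    (ℤ.i≡j⇒i-j≡0 (gf≗hf m))
    where open SeriesSolver

-- The quotient φ = (q)_∞ / (-q)_∞ and its reduction modulo 2

factor-cong : ∀ s k m s′ k′ m′ → s + k * m ≡ s′ + k′ * m′ → factor (q^ s) k m ≗ factor (q^ s′) k′ m′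
factor-cong s k m s′ k′ m′ eq n = trans (factor-q^ s k m n)
  (trans (cong (λ e → (𝟙 ⊖ q^ e) n) eq) (sym (factor-q^ s′ k′ m′ n)))

factor-⊝q^ : ∀ s k m → factor (⊝ q^ s) k m ≗ 𝟙 ⊖ ⊝ q^ (s + k * m)
factor-⊝q^ s k m n = cong (ℤ._-_ (𝟙 n)) (trans
  (solve 2 (λ x y → :- x :* y := :- (x :* y)) ≗-refl (q^ s) (q^ (k * m)) n)
  (cong ℤ.-_ (q^-⊗ s (k * m) n)))
  where open SeriesSolver

-- `Q` is now (q)_∞, no longer q^k, and `E` is (-q)_∞. The form of `φ` makes it the triple product
-- with k = 2 and s = t = 1 by definition.
E Q O W φ : Series
E = ⟨ ⊝ q^ 1 ,q^ 1 ⟩∞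
Q = ⟨ q^ 1 ,q^ 1 ⟩∞
O = ⟨ q^ 1 ,q^ 2 ⟩∞
W = ⟨ q^ 2 ,q^ 2 ⟩∞
φ = O ⊗ O ⊗ W

E⊗Q≗W : E ⊗ Q ≗ W
E⊗Q≗W n = begin
  (E ⊗ Q) n                    ≡⟨ ≈-⊗ (poch≈∏ (⊝ q^ 1) 1 n refl ≤-refl) (poch-q^≈∏ 1 1 n ≤-refl ≤-refl) n (n<1+n n) ⟩
  (∏ n F⁻ ⊗ ∏ n F⁺) n          ≡⟨ ∏-⊗ n F⁻ F⁺ n ⟨
  ∏ n (λ m → F⁻ m ⊗ F⁺ m) n    ≡⟨ ∏-cong n difference-of-squares n ⟩
  W n                          ∎
  where
  open ≡-Reasoning
  F⁻ F⁺ : ℕ → Series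
  F⁻ = factor (⊝ q^ 1) 1
  F⁺ = factor (q^ 1) 1
  difference-of-squares : ∀ m → F⁻ m ⊗ F⁺ m ≗ factor (q^ 2) 2 m
  difference-of-squares m l = begin
    (F⁻ m ⊗ F⁺ m) l                    ≡⟨ ⊗-cong (factor-⊝q^ 1 1 m) (factor-q^ 1 1 m) l ⟩
    ((𝟙 ⊖ ⊝ x) ⊗ (𝟙 ⊖ x)) l            ≡⟨ solve 2 (λ u x → (u :- :- x) :* (u :- x) := u :* u :- x :* x) ≗-refl 𝟙 x l ⟩
    (𝟙 ⊗ 𝟙 ⊖ x ⊗ x) l                  ≡⟨ cong₂ ℤ._-_ (⊗-identityˡ 𝟙 l) (q^-⊗ (1 + 1 * m) (1 + 1 * m) l) ⟩
    (𝟙 ⊖ q^ (1 + 1 * m + (1 + 1 * m))) l ≡⟨ cong (λ e → (𝟙 ⊖ q^ e) l) (exponents m) ⟩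
    (𝟙 ⊖ q^ (2 + 2 * m)) l             ≡⟨ factor-q^ 2 2 m l ⟨
    factor (q^ 2) 2 m l                ∎
    where
    open SeriesSolver
    x : Series
    x = q^ (1 + 1 * m)
    exponents : ∀ m → 1 + 1 * m + (1 + 1 * m) ≡ 2 + 2 * m
    exponents = solve-∀

-- The factors 1 - q^j are sorted by the parity of j; 2n of them are taken so that they pair up.
Q≗O⊗W : Q ≗ O ⊗ W
Q≗O⊗W n = begin
  Q n                                       ≡⟨ poch-q^≈∏ 1 1 (n * 2) ≤-refl ≤-refl n (s≤s (m≤m*n n 2)) ⟩
  ∏ (n * 2) F n                             ≡⟨ ∏-pairs n F n ⟩
  ∏ n (λ m → F (m * 2) ⊗ F (suc (m * 2))) n
    ≡⟨ ∏-cong n (λ m → ⊗-cong (factor-cong 1 1 (m * 2) 1 2 m (odds m)) (factor-cong 1 1 (suc (m * 2)) 2 2 m (evens m))) n ⟩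
  ∏ n (λ m → factor (q^ 1) 2 m ⊗ factor (q^ 2) 2 m) n
    ≡⟨ ∏-⊗ n (factor (q^ 1) 2) (factor (q^ 2) 2) n ⟩
  (∏ n (factor (q^ 1) 2) ⊗ ∏ n (factor (q^ 2) 2)) n
    ≡⟨ ≈-⊗ (poch-q^≈∏ 1 2 n ≤-refl (s≤s z≤n)) (poch-q^≈∏ 2 2 n (s≤s z≤n) (s≤s z≤n)) n (n<1+n n) ⟨
  (O ⊗ W) n                                 ∎
  where
  open ≡-Reasoning
  F : ℕ → Series
  F = factor (q^ 1) 1
  odds : ∀ m → 1 + 1 * (m * 2) ≡ 1 + 2 * m
  odds = solve-∀
  evens : ∀ m → 1 + 1 * suc (m * 2) ≡ 2 + 2 * m
  evens = solve-∀

-- This is φ (-q)_∞ = (q)_∞ multiplied by `W`, which supplies the second copy of `O ⊗ W`. The factor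
-- `E ⊗ W` has constant term 1 and is cancelled where the relation is used.
φ⊗[E⊗W]≗Q⊗W : φ ⊗ (E ⊗ W) ≗ Q ⊗ W
φ⊗[E⊗W]≗Q⊗W = begin
  O ⊗ O ⊗ W ⊗ (E ⊗ W)      ≈⟨ solve 3 (λ o w e → o :* o :* w :* (e :* w) := e :* (o :* w) :* (o :* w)) ≗-refl O W E ⟩
  E ⊗ (O ⊗ W) ⊗ (O ⊗ W)    ≈⟨ ⊗-cong (⊗-congˡ E Q≗O⊗W) Q≗O⊗W ⟨
  E ⊗ Q ⊗ Q                ≈⟨ ⊗-congʳ Q E⊗Q≗W ⟩
  W ⊗ Q                    ≈⟨ ⊗-comm W Q ⟩
  Q ⊗ W                    ∎
  where
  open SetoidReasoning setoid
  open SeriesSolver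

2∣Q-E : ∀ n → + 2 ∣ (Q ⊖ E) n
2∣Q-E n = finite n n
  where
  F⁻ F⁺ : ℕ → Series
  F⁻ = factor (⊝ q^ 1) 1
  F⁺ = factor (q^ 1) 1
  2∣F⁺-F⁻ : ∀ m n → + 2 ∣ (F⁺ m ⊖ F⁻ m) n
  2∣F⁺-F⁻ m n = divides (ℤ.- x) (trans
    (cong₂ ℤ._-_ (factor-q^ 1 1 m n) (factor-⊝q^ 1 1 m n))
    (solve 2 (λ u x → (u :- x) :- (u :- :- x) := :- x :* con (+ 2)) refl (𝟙 n) x))
    where
    open +-*-Solver
    x : ℤ
    x = (q^ (1 + 1 * m)) n
  finite : ∀ M n → + 2 ∣ (∏ M F⁺ ⊖ ∏ M F⁻) n
  finite zero    n = divides 0ℤ (ℤ.+-inverseʳ (𝟙 n))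
  finite (suc M) n = ∣-trans
    (∣m∣n⇒∣m+n (∣-⊗ˡ (F⁺ M ⊖ F⁻ M) (∏ M F⁺) (2∣F⁺-F⁻ M) n) (∣-⊗ʳ (F⁻ M) (∏ M F⁺ ⊖ ∏ M F⁻) (finite M) n))
    (∣-reflexive
      -- Only one of the two factors changes at a time: the first difference is even by `2∣F⁺-F⁻`,
      -- the second by induction.
      (solve 4 (λ a b x y → (a :- b) :* x :+ b :* (x :- y) := a :* x :- b :* y) ≗-refl
        (F⁺ M) (F⁻ M) (∏ M F⁺) (∏ M F⁻) n))
    where open SeriesSolver

2∣φ-1 : ∀ n → + 2 ∣ (φ ⊖ 𝟙) n
2∣φ-1 = ∣-cancelʳ (E ⊗ W) (φ ⊖ 𝟙) refl λ n →
  ∣-trans (∣-⊗ˡ (Q ⊖ E) W 2∣Q-E n) (∣-reflexive (sym (identity n)))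
  where
  identity : (φ ⊖ 𝟙) ⊗ (E ⊗ W) ≗ (Q ⊖ E) ⊗ W
  identity n = begin
    ((φ ⊖ 𝟙) ⊗ (E ⊗ W)) n               ≡⟨ solve 3 (λ f u x → (f :- u) :* x := f :* x :- u :* x) ≗-refl φ 𝟙 (E ⊗ W) n ⟩
    (φ ⊗ (E ⊗ W) ⊖ 𝟙 ⊗ (E ⊗ W)) n       ≡⟨ cong₂ ℤ._-_ (φ⊗[E⊗W]≗Q⊗W n) (⊗-identityˡ (E ⊗ W) n) ⟩
    (Q ⊗ W ⊖ E ⊗ W) n                   ≡⟨ solve 3 (λ q e w → q :* w :- e :* w := (q :- e) :* w) ≗-refl Q E W n ⟩
    ((Q ⊖ E) ⊗ W) n                     ∎
    where
    open ≡-Reasoning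
    open SeriesSolver

⊘Q⊗φ : ∀ Θ → ((E ⊗ Θ) ⊘ Q) ⊗ φ ≗ Θ
⊘Q⊗φ Θ = ⊗-cancelʳ (E ⊗ W) (G ⊗ φ) Θ refl (begin
  G ⊗ φ ⊗ (E ⊗ W)      ≈⟨ ⊗-assoc G φ (E ⊗ W) ⟩
  G ⊗ (φ ⊗ (E ⊗ W))    ≈⟨ ⊗-congˡ G φ⊗[E⊗W]≗Q⊗W ⟩
  G ⊗ (Q ⊗ W)          ≈⟨ ⊗-assoc G Q W ⟨
  G ⊗ Q ⊗ W            ≈⟨ ⊗-congʳ W (⊘-⊗ (E ⊗ Θ) Q refl) ⟩
  E ⊗ Θ ⊗ W            ≈⟨ solve 3 (λ e h w → e :* h :* w := h :* (e :* w)) ≗-refl E Θ W ⟩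
  Θ ⊗ (E ⊗ W)          ∎)
  where
  open SetoidReasoning setoid
  open SeriesSolver
  G : Series
  G = (E ⊗ Θ) ⊘ Q

4∣⊘Q : ∀ Θ n → Θ n ≡ 0ℤ → (Θ ⊗ (φ ⊖ 𝟙)) n ≡ 0ℤ → + 4 ∣ ((E ⊗ Θ) ⊘ Q) n
4∣⊘Q Θ n Θₙ≡0 ΘDₙ≡0 = ∣-trans (∣-⊗ʳ G (D ⊗ D) (∣-⊗ D D 2∣φ-1 2∣φ-1) n)
  (∣-reflexive (sym (begin
    -- The expansion 1/(1 + D) = 1 - D + D²/(1 + D), with G (1 + D) = Θ written as `G⁺`.
    G n                                      ≡⟨ solve 2 (λ g d → g := g :+ g :* d :- (g :+ g :* d) :* d :+ g :* (d :* d)) ≗-refl G D n ⟩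
    (G⁺ ⊖ G⁺ ⊗ D ⊕ G ⊗ (D ⊗ D)) n
      ≡⟨ cong (ℤ._+ (G ⊗ (D ⊗ D)) n) (cong₂ ℤ._-_ (trans (G⁺≗Θ n) Θₙ≡0) (trans (⊗-congʳ D G⁺≗Θ n) ΘDₙ≡0)) ⟩
    0ℤ ℤ.+ (G ⊗ (D ⊗ D)) n                   ≡⟨ ℤ.+-identityˡ _ ⟩
    (G ⊗ (D ⊗ D)) n                          ∎)))
  where
  open ≡-Reasoning
  open SeriesSolver
  G D G⁺ : Series
  G = (E ⊗ Θ) ⊘ Q
  D = φ ⊖ 𝟙
  G⁺ = G ⊕ G ⊗ D
  G⁺≗Θ : G⁺ ≗ Θ
  G⁺≗Θ m = begin
    G⁺ m                                ≡⟨ cong (ℤ._+ (G ⊗ D) m) (trans (⊗-comm G 𝟙 m) (⊗-identityˡ G m)) ⟨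
    (G ⊗ 𝟙 ⊕ G ⊗ (φ ⊖ 𝟙)) m             ≡⟨ solve 3 (λ g u f → g :* u :+ g :* (f :- u) := g :* f) ≗-refl G 𝟙 φ m ⟩
    (G ⊗ φ) m                           ≡⟨ ⊘Q⊗φ Θ m ⟩
    Θ m                                 ∎

-- Residues of the exponents

%9-≡⇒%3-≡ : ∀ m n → m % 9 ≡ n % 9 → m % 3 ≡ n % 3
%9-≡⇒%3-≡ m n eq = trans (sym (m∣n⇒o%n%m≡o%m 3 9 m (divides-refl 3)))
  (trans (cong (_% 3) eq) (m∣n⇒o%n%m≡o%m 3 9 n (divides-refl 3)))

-- Three consecutive increments of the quadratic exponent add up to three times the middle one. This
-- gives period 3 in m modulo 3, and modulo 9 in the class where the middle increment is divisible
-- by 3.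
exponent-suc³ : ∀ k s m → exponent k s (3 + m) ≡ 3 * (s + k * suc m) + exponent k s m
exponent-suc³ k s m = identity k s m (exponent k s m)
  where
  identity : ∀ k s m e →
    (s + k * (2 + m)) + ((s + k * (1 + m)) + ((s + k * m) + e)) ≡ 3 * (s + k * suc m) + e
  identity = solve-∀

0∨i : ℕ → ℕ → Set
0∨i i e = e % 3 ≡ 0 ⊎ e % 9 ≡ i % 9

exponent-%3 : ∀ k s l r → (exponent k s (r + l * 3)) % 3 ≡ (exponent k s r) % 3
exponent-%3 k s zero    r = cong (λ m → exponent k s m % 3) (+-identityʳ r)
exponent-%3 k s (suc l) r = begin
  exponent k s (r + (3 + l * 3)) % 3             ≡⟨ cong (λ m → exponent k s m % 3) (shift r l) ⟩
  exponent k s (3 + (r + l * 3)) % 3             ≡⟨ cong (_% 3) (trans (exponent-suc³ k s (r + l * 3)) (swap x e)) ⟩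
  (e + x * 3) % 3                                ≡⟨ [m+kn]%n≡m%n e x 3 ⟩
  e % 3                                          ≡⟨ exponent-%3 k s l r ⟩
  exponent k s r % 3                             ∎
  where
  open ≡-Reasoning
  x e : ℕ
  x = s + k * suc (r + l * 3)
  e = exponent k s (r + l * 3)
  shift : ∀ r l → r + (3 + l * 3) ≡ 3 + (r + l * 3)
  shift = solve-∀
  swap : ∀ x e → 3 * x + e ≡ e + x * 3
  swap = solve-∀

-- Going on from r + 3l adds 3 (s + k (r + 1)) + 9kl, and the hypothesis makes the first summand a
-- multiple of 9.
exponent-%9 : ∀ k s l r c → s + k * suc r ≡ c * 3 → (exponent k s (r + l * 3)) % 9 ≡ (exponent k s r) % 9
exponent-%9 k s zero    r c eq = cong (λ m → exponent k s m % 9) (+-identityʳ r)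
exponent-%9 k s (suc l) r c eq = begin
  exponent k s (r + (3 + l * 3)) % 9                ≡⟨ cong (λ m → exponent k s m % 9) (shift r l) ⟩
  exponent k s (3 + (r + l * 3)) % 9                ≡⟨ cong (_% 9) (exponent-suc³ k s (r + l * 3)) ⟩
  (3 * (s + k * suc (r + l * 3)) + e) % 9           ≡⟨ cong (_% 9) (regroup k s r l e) ⟩
  (e + 3 * (s + k * suc r) + k * l * 9) % 9         ≡⟨ cong (λ x → (e + 3 * x + k * l * 9) % 9) eq ⟩
  (e + 3 * (c * 3) + k * l * 9) % 9                 ≡⟨ cong (_% 9) (regroup′ e c (k * l)) ⟩
  (e + (c + k * l) * 9) % 9                         ≡⟨ [m+kn]%n≡m%n e (c + k * l) 9 ⟩
  e % 9                                             ≡⟨ exponent-%9 k s l r c eq ⟩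
  exponent k s r % 9                                ∎
  where
  open ≡-Reasoning
  e : ℕ
  e = exponent k s (r + l * 3)
  shift : ∀ r l → r + (3 + l * 3) ≡ 3 + (r + l * 3)
  shift = solve-∀
  regroup : ∀ k s r l e → 3 * (s + k * suc (r + l * 3)) + e ≡ e + 3 * (s + k * suc r) + k * l * 9
  regroup = solve-∀
  regroup′ : ∀ e c y → e + 3 * (c * 3) + y * 9 ≡ e + (c + y) * 9
  regroup′ = solve-∀

-- With k = i + t, the exponents for m = 0, 1, 2 are 0, i and 2i + k, the last divisible by 3
-- because i ≡ k ≡ 2. The class of m = 1 is constant modulo 9 since 3 divides i + 2k.
exponent-i : ∀ i t a b → i ≡ 2 + a * 3 → t ≡ b * 3 → ∀ m → 0∨i i (exponent (i + t) i m)
exponent-i i t a b refl refl m with m divMod 3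
... | result l zero refl             = inj₁ (exponent-%3 (i + t) i l 0)
... | result l (suc zero) refl       = inj₂ (trans
  (exponent-%9 (i + t) i l 1 (2 + 3 * a + 2 * b) (identity₁ a b)) (cong (_% 9) (identity₂ a b)))
  where
  identity₁ : ∀ a b → 2 + a * 3 + (2 + a * 3 + b * 3) * 2 ≡ (2 + 3 * a + 2 * b) * 3
  identity₁ = solve-∀
  identity₂ : ∀ a b → 2 + a * 3 + (2 + a * 3 + b * 3) * 0 + 0 ≡ 2 + a * 3
  identity₂ = solve-∀
... | result l (suc (suc zero)) refl = inj₁ (trans
  (exponent-%3 (i + t) i l 2) (trans (cong (_% 3) (identity a b)) (m*n%n≡0 (2 + 3 * a + b) 3)))
  where
  identity : ∀ a b → 2 + a * 3 + (2 + a * 3 + b * 3) * 1 + (2 + a * 3 + (2 + a * 3 + b * 3) * 0 + 0)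
             ≡ (2 + 3 * a + b) * 3
  identity = solve-∀

-- The exponents for m = 0, 1, 2 are 0, t and 2t + k = i + 3t. As 3 divides t, the last is i modulo
-- 9, and its class is constant modulo 9 since 3 divides t + 3k.
exponent-t : ∀ i t a b → i ≡ 2 + a * 3 → t ≡ b * 3 → ∀ m → 0∨i i (exponent (i + t) t m)
exponent-t i t a b refl refl m with m divMod 3
... | result l zero refl             = inj₁ (exponent-%3 (i + t) t l 0)
... | result l (suc zero) refl       = inj₁ (trans
  (exponent-%3 (i + t) t l 1) (trans (cong (_% 3) (identity a b)) (m*n%n≡0 b 3)))
  where
  identity : ∀ a b → b * 3 + (2 + a * 3 + b * 3) * 0 + 0 ≡ b * 3
  identity = solve-∀
... | result l (suc (suc zero)) refl = inj₂ (trans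
  (exponent-%9 (i + t) t l 2 (2 + 3 * a + 4 * b) (identity₁ a b))
  (trans (cong (_% 9) (identity₂ a b)) ([m+kn]%n≡m%n (2 + a * 3) b 9)))
  where
  identity₁ : ∀ a b → b * 3 + (2 + a * 3 + b * 3) * 3 ≡ (2 + 3 * a + 4 * b) * 3
  identity₁ = solve-∀
  identity₂ : ∀ a b → b * 3 + (2 + a * 3 + b * 3) * 1 + (b * 3 + (2 + a * 3 + b * 3) * 0 + 0)
              ≡ 2 + a * 3 + b * 9
  identity₂ = solve-∀

exponent-square : ∀ m → exponent 2 1 m ≡ m * m
exponent-square zero    = refl
exponent-square (suc m) = trans (cong (λ e → 1 + 2 * m + e) (exponent-square m)) (identity m)
  where
  identity : ∀ m → 1 + 2 * m + m * m ≡ suc m * suc m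
  identity = solve-∀

square-residue : ∀ m → (m * m) % 9 ≡ 0 ⊎ (m * m) % 3 ≡ 1
square-residue m with m divMod 3
... | result l zero refl = inj₁ (trans (cong (_% 9) (identity l)) (m*n%n≡0 (l * l) 9))
  where
  identity : ∀ l → l * 3 * (l * 3) ≡ l * l * 9
  identity = solve-∀
... | result l (suc zero) refl = inj₂ (trans (cong (_% 3) (identity l)) ([m+kn]%n≡m%n 1 (2 * l + 3 * l * l) 3))
  where
  identity : ∀ l → (1 + l * 3) * (1 + l * 3) ≡ 1 + (2 * l + 3 * l * l) * 3
  identity = solve-∀
... | result l (suc (suc zero)) refl = inj₂ (trans (cong (_% 3) (identity l)) ([m+kn]%n≡m%n 1 (1 + 4 * l + 3 * l * l) 3))
  where
  identity : ∀ l → (2 + l * 3) * (2 + l * 3) ≡ 1 + (1 + 4 * l + 3 * l * l) * 3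
  identity = solve-∀

-- For k = 2 and s = t = 1 both families of exponents are the squares.
φ-1-support : ∀ n → ¬ (n % 9 ≡ 0 ⊎ n % 3 ≡ 1) → (φ ⊖ 𝟙) n ≡ 0ℤ
φ-1-support zero    ¬square = contradiction (inj₁ refl) ¬square
φ-1-support (suc n) ¬square = cong (ℤ._- 0ℤ)
  (JacobiTriple.triple-support 2 1 1 ≤-refl ≤-refl refl (suc n) ≢square ≢square)
  where
  ≢square : ∀ m → suc n ≢ exponent 2 1 m
  ≢square m eq = ¬square (subst (λ e → e % 9 ≡ 0 ⊎ e % 3 ≡ 1)
    (sym (trans eq (exponent-square m))) (square-residue m))

+-%3 : ∀ x y {a b} → x % 3 ≡ a → y % 3 ≡ b → (x + y) % 3 ≡ (a + b) % 3
+-%3 x y x≡a y≡b = trans (%-distribˡ-+ x y 3) (cong₂ (λ u v → (u + v) % 3) x≡a y≡b)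

-- Modulo 3 the possible sums are 0 + 0, 0 + 1, 2 + 1 and 2 + 0. Only the last is 2, and there y
-- vanishes even modulo 9.
0∨i-+-square : ∀ i x y → i % 3 ≡ 2 → 0∨i i x → y % 9 ≡ 0 ⊎ y % 3 ≡ 1 →
               (x + y) % 3 ≡ 2 → (x + y) % 9 ≡ i % 9
0∨i-+-square i x y i≡2 (inj₁ x≡0) (inj₁ y≡0) x+y≡2 =
  contradiction (trans (sym x+y≡2) (+-%3 x y x≡0 (%9-≡⇒%3-≡ y 0 y≡0))) λ ()
0∨i-+-square i x y i≡2 (inj₁ x≡0) (inj₂ y≡1) x+y≡2 =
  contradiction (trans (sym x+y≡2) (+-%3 x y x≡0 y≡1)) λ ()
0∨i-+-square i x y i≡2 (inj₂ x≡i) (inj₂ y≡1) x+y≡2 =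
  contradiction (trans (sym x+y≡2) (+-%3 x y (trans (%9-≡⇒%3-≡ x i x≡i) i≡2) y≡1)) λ ()
0∨i-+-square i x y i≡2 (inj₂ x≡i) (inj₁ y≡0) _ = begin
  (x + y) % 9           ≡⟨ %-distribˡ-+ x y 9 ⟩
  (x % 9 + y % 9) % 9   ≡⟨ cong₂ (λ u v → (u + v) % 9) x≡i y≡0 ⟩
  (i % 9 + 0) % 9       ≡⟨ cong (_% 9) (+-identityʳ (i % 9)) ⟩
  i % 9 % 9             ≡⟨ m%n%n≡m%n i 9 ⟩
  i % 9                 ∎
  where open ≡-Reasoning

-- Vanishing of the coefficients of Θ and Θ D

∸-%3 : ∀ k i → k % 3 ≡ 2 → i % 3 ≡ 2 → ∃[ b ] k ∸ i ≡ b * 3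
∸-%3 k i k≡2 i≡2 = k / 3 ∸ i / 3 , (begin
  k ∸ i                              ≡⟨ cong₂ _∸_ (m≡m%n+[m/n]*n k 3) (m≡m%n+[m/n]*n i 3) ⟩
  k % 3 + k / 3 * 3 ∸ (i % 3 + i / 3 * 3)
    ≡⟨ cong₂ (λ u v → u + k / 3 * 3 ∸ (v + i / 3 * 3)) k≡2 i≡2 ⟩
  k / 3 * 3 ∸ i / 3 * 3              ≡⟨ *-distribʳ-∸ 3 (k / 3) (i / 3) ⟨
  (k / 3 ∸ i / 3) * 3                ∎)
  where open ≡-Reasoning

4∣S : ∀ k i n → 1 ≤ i → 2 * i ≤ k → k % 3 ≡ 2 → i % 3 ≡ 2 → n % 3 ≡ 2 → n % 9 ≢ i % 9 → + 4 ∣ S k i n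
-- By definition `genFun k i` is `(E ⊗ triple) ⊘ Q`, with s = i and t = k - i.
4∣S k i n 1≤i 2i≤k k≡2 i≡2 n≡2 n≢i = 4∣⊘Q triple n (Θ-support n n∉) ΘDₙ≡0
  where
  i≤k∸i : i ≤ k ∸ i
  i≤k∸i = m+n≤o⇒m≤o∸n i (≤-trans (≤-reflexive (cong (_+_ i) (sym (+-identityʳ i)))) 2i≤k)
  i+[k∸i]≡k : i + (k ∸ i) ≡ k
  i+[k∸i]≡k = m+[n∸m]≡n (≤-trans (m≤m+n i (i + 0)) 2i≤k)
  open JacobiTriple k i (k ∸ i) 1≤i (≤-trans 1≤i i≤k∸i) i+[k∸i]≡k
  i≡2+ : i ≡ 2 + i / 3 * 3
  i≡2+ = trans (m≡m%n+[m/n]*n i 3) (cong (λ r → r + i / 3 * 3) i≡2)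
  Θ-support : ∀ n → ¬ 0∨i i n → triple n ≡ 0ℤ
  Θ-support n n∉ with (b , k∸i≡) ← ∸-%3 k i k≡2 i≡2 = triple-support n
    (λ m n≡e → n∉ (subst (0∨i i) (sym n≡e)
      (subst (λ k′ → 0∨i i (exponent k′ i m)) i+[k∸i]≡k (exponent-i i (k ∸ i) (i / 3) b i≡2+ k∸i≡ m))))
    (λ m n≡e → n∉ (subst (0∨i i) (sym n≡e)
      (subst (λ k′ → 0∨i i (exponent k′ (k ∸ i) m)) i+[k∸i]≡k (exponent-t i (k ∸ i) (i / 3) b i≡2+ k∸i≡ m))))
  n∉ : ¬ 0∨i i n
  n∉ (inj₁ n≡0) = contradiction (trans (sym n≡2) n≡0) λ ()
  n∉ (inj₂ n≡i) = n≢i n≡i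
  ΘDₙ≡0 : (triple ⊗ (φ ⊖ 𝟙)) n ≡ 0ℤ
  ΘDₙ≡0 = sum-zero {suc n} _ term
    where
    term : (j : Fin (suc n)) → triple (toℕ j) ℤ.* (φ ⊖ 𝟙) (n ∸ toℕ j) ≡ 0ℤ
    term j with toℕ j % 3 ≟ 0 ⊎-dec toℕ j % 9 ≟ i % 9
    ... | no j∉ = trans (cong (ℤ._* (φ ⊖ 𝟙) (n ∸ toℕ j)) (Θ-support (toℕ j) j∉)) (ℤ.*-zeroˡ ((φ ⊖ 𝟙) (n ∸ toℕ j)))
    -- If n - j also had a residue allowed for D, then n ≡ 2 modulo 3 would force n ≡ i modulo 9.
    ... | yes j∈ = trans
      (cong (triple (toℕ j) ℤ.*_) (φ-1-support (n ∸ toℕ j) λ l∈ → n≢i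
        (subst (λ m → m % 9 ≡ i % 9) j+[n∸j]≡n
          (0∨i-+-square i (toℕ j) (n ∸ toℕ j) i≡2 j∈ l∈ (subst (λ m → m % 3 ≡ 2) (sym j+[n∸j]≡n) n≡2)))))
      (ℤ.*-zeroʳ (triple (toℕ j)))
      where
      j+[n∸j]≡n : toℕ j + (n ∸ toℕ j) ≡ n
      j+[n∸j]≡n = m+[n∸m]≡n (toℕ≤pred[n] j)

[9n+r]%9≡r%9 : ∀ n r → (9 * n + r) % 9 ≡ r % 9
[9n+r]%9≡r%9 n r = trans (cong (_% 9) (trans (+-comm (9 * n) r) (cong (_+_ r) (*-comm 9 n)))) ([m+kn]%n≡m%n r n 9)

mainTheorem2 : (k i : ℕ) → 1 ≤ i → 2 * i ≤ k → k % 3 ≡ 2 → (n : ℕ) →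
    (i % 9 ≡ 2 → (+ 4 ∣ S k i (9 * n + 5)) × (+ 4 ∣ S k i (9 * n + 8)))
    × (i % 9 ≡ 5 → (+ 4 ∣ S k i (9 * n + 2)) × (+ 4 ∣ S k i (9 * n + 8)))
    × (i % 9 ≡ 8 → (+ 4 ∣ S k i (9 * n + 2)) × (+ 4 ∣ S k i (9 * n + 5)))
mainTheorem2 k i 1≤i 2i≤k k≡2 n =
    (λ i≡2 → vanish 2 5 i≡2 refl refl (λ ()) , vanish 2 8 i≡2 refl refl (λ ()))
  , (λ i≡5 → vanish 5 2 i≡5 refl refl (λ ()) , vanish 5 8 i≡5 refl refl (λ ()))
  , (λ i≡8 → vanish 8 2 i≡8 refl refl (λ ()) , vanish 8 5 i≡8 refl refl (λ ()))
  where
  -- The residues 2, 5, 8 modulo 9 are exactly those that are 2 modulo 3, so each claim concerns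
  -- such a residue m different from r.
  vanish : ∀ r m → i % 9 ≡ r → r % 3 ≡ 2 → m % 3 ≡ 2 → m % 9 ≢ r → + 4 ∣ S k i (9 * n + m)
  vanish r m i≡r r≡2 m≡2 m≢r = 4∣S k i (9 * n + m) 1≤i 2i≤k k≡2
    (trans (sym (m∣n⇒o%n%m≡o%m 3 9 i (divides-refl 3))) (trans (cong (_% 3) i≡r) r≡2))
    (trans (%9-≡⇒%3-≡ (9 * n + m) m ([9n+r]%9≡r%9 n m)) m≡2)
    (λ eq → m≢r (trans (sym ([9n+r]%9≡r%9 n m)) (trans eq i≡r)))
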